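{- For $2\le n\le 6$, $\psi(K(n,2))=\alpha(K(n,2))$. For every $n\ge 7$, \[\left\lfloor \frac{\binom{n}{2}}{2}\right\rfloor\le \psi(K(n,2))\le \left\lfloor \frac{\binom{n}{2}+\lfloor n/2\rfloor}{2}\right\rfloor.\] Moreover, if $n\ge 7$ and $n+1\equiv 1$ or $5 \pmod{20}$, then $\psi(K(n,2))=\left\lfloor \frac{\binom{n}{2}+\lfloor n/2\rfloor}{2}\right\rfloor$.
   Context: The Kneser graph $K(n,2)$ has as vertices all $2$-element subsets of $[n]=\{1,\dots,n\}$, two vertices being adjacent iff the subsets are disjoint. An $l$-coloring of a graph $G$ is a surjective map from $V(G)$ onto $[l]$; it is proper if adjacent vertices receive different colors, and complete if for every pair of distinct colors $i,j$ there is an edge $xy$ with $x$ colored $i$ and $y$ colored $j$. The pseudoachromatic number $\psi(G)$ is the largest $l$ for which $G$ has a complete $l$-coloring (not necessarily proper); the achromatic number $\alpha(G)$ is the largest $l$ for which $G$ has a proper complete $l$-coloring. -}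

module Defs where

open import Level using (0ℓ)
open import Data.Nat using (ℕ; _≤_; _+_; _/_)
open import Data.Nat.Combinatorics using (_C_)
open import Data.Fin using (Fin; _<_)
open import Data.Product using (Σ; ∃; ∃-syntax; _×_; _,_; proj₁; proj₂)
open import Relation.Binary.PropositionalEquality using (_≡_; _≢_)
open import Relation.Nullary using (¬_)

record Graph : Set₁ where
  field
    V   : Set
    Adj : V → V → Set
open Graph public

-- Kneser graph K(n,2): vertices are 2-subsets {i,j} of [n], encoded as i < j in Fin n.
KVertex : ℕ → Set
KVertex n = Σ (Fin n × Fin n) (λ p → proj₁ p < proj₂ p)

Disjoint₂ : ∀ {n} → KVertex n → KVertex n → Set
Disjoint₂ ((i , j) , _) ((k , l) , _) = (i ≢ k) × (i ≢ l) × (j ≢ k) × (j ≢ l)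

Kneser2 : ℕ → Graph
Kneser2 n = record { V = KVertex n ; Adj = Disjoint₂ }

-- An l-coloring: a surjective map V(G) → [l] (colors are Fin l).
Surjective : {A B : Set} → (A → B) → Set
Surjective {A} {B} f = (b : B) → ∃[ a ] f a ≡ b

IsProper : (G : Graph) {l : ℕ} → (V G → Fin l) → Set
IsProper G c = ∀ x y → Adj G x y → c x ≢ c y

IsComplete : (G : Graph) {l : ℕ} → (V G → Fin l) → Set
IsComplete G {l} c = (a b : Fin l) → a ≢ b →
  ∃[ x ] ∃[ y ] (Adj G x y × c x ≡ a × c y ≡ b)

HasCompleteColoring : Graph → ℕ → Set
HasCompleteColoring G l = Σ (V G → Fin l) (λ c → Surjective c × IsComplete G c)

HasProperCompleteColoring : Graph → ℕ → Set
HasProperCompleteColoring G l =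
  Σ (V G → Fin l) (λ c → Surjective c × IsComplete G c × IsProper G c)

IsPseudoachromaticNumber : Graph → ℕ → Set
IsPseudoachromaticNumber G k =
  HasCompleteColoring G k × (∀ l → HasCompleteColoring G l → l ≤ k)

IsAchromaticNumber : Graph → ℕ → Set
IsAchromaticNumber G k =
  HasProperCompleteColoring G k × (∀ l → HasProperCompleteColoring G l → l ≤ k)

lowerBound : ℕ → ℕ
lowerBound n = (n C 2) / 2

upperBound : ℕ → ℕ
upperBound n = ((n C 2) + (n / 2)) / 2

{-# OPTIONS --safe #-}
-- Upper bound: in a complete coloring the singleton classes are pairwise disjoint edges of the
-- complete graph on [n], so there are at most ⌊n/2⌋ of them, and every other class has at least
-- two of the n C 2 edges.  For n ≤ 6 one uses instead that, in the presence of a singleton class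
-- {e}, each other class contains one of the edges disjoint from e.
--
-- For every n ≥ 8 the upper bound is attained, by induction in steps of 4 from n = 8, 9, 10, 11.
-- Add vertices u, v, u′, v′ and let σ be the cyclic shift of [n].  Add the color classes
-- {ui, vσ(i)}, {u′i, v′σ(i)} for i in [n], {uu′} and {vv′}, and replace two of the old classes
-- {e₁, f₁}, {e₂, f₂} by {uv, e₁}, {u′v′, f₁}, {uv′, e₂}, {u′v, f₂}.  Since σ has no 2-cycles the
-- result is complete, provided every old class, {e₁} and {f₁} contain an edge other than {i, σ(i)},
-- for each i.  This adds 2n + 4 colors, as
-- does the upper bound.
--
-- For n = 7 there is a coloring with 11 colors, and the upper bound is 12; a finite search decides
-- which of the two is the pseudoachromatic number.
module Submission where

open import Defs
open import Data.Bool using (Bool; true; false; T; not; _∧_)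
open import Data.Bool.Properties using (T?; T-∧)
open import Data.Fin using (Fin; zero; suc; toℕ; fromℕ<; punchIn; punchOut; _↑ˡ_; _↑ʳ_; splitAt)
import Data.Fin as Fin
import Data.Fin.Properties as Fin
open import Data.List using (List; []; _∷_; _++_; map; length; applyUpTo)
import Data.List as List
open import Data.List.Membership.Propositional using (lose)
open import Data.List.Membership.Propositional.Properties using (∈-lookup)
open import Data.List.Properties using (length-++; length-map; length-applyUpTo)
open import Data.List.Relation.Unary.All using (All; []; _∷_; all?)
import Data.List.Relation.Unary.All as All
import Data.List.Relation.Unary.All.Properties as All
open import Data.List.Relation.Unary.AllPairs using (AllPairs; []; _∷_; allPairs?)
import Data.List.Relation.Unary.AllPairs as AllPairs
import Data.List.Relation.Unary.AllPairs.Properties as AllPairs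
open import Data.List.Relation.Unary.Any using (Any)
import Data.List.Relation.Unary.Any as Any
open import Data.List.Relation.Unary.Any.Properties using (lookup-index)
open import Data.Nat using (ℕ; zero; suc; _≤_; _<_; _+_; _*_; _/_; _%_; _≡ᵇ_; NonZero; z≤n; s≤s)
open import Data.Nat.Combinatorics using (_C_; nC1≡n; nCk+nC[k+1]≡[n+1]C[k+1])
open import Data.Nat.Divisibility using (divides-refl)
open import Data.Nat.DivMod
  using (_mod_; m≡m%n+[m/n]*n; m%n<n; m*n/n≡m; /-monoˡ-≤; +-distrib-/-∣ˡ; +-distrib-/-∣ʳ)
import Data.Nat.Properties as ℕ
open import Data.Nat.Tactic.RingSolver using (solve-∀)
open import Data.Product using (∃; ∃-syntax; _×_; _,_; proj₁; proj₂)
open import Data.Product.Function.NonDependent.Propositional using (_×-↔_)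
open import Data.Product.Properties using (≡-dec; ,-injective; ,-injectiveʳ)
open import Data.Sum using (_⊎_; inj₁; inj₂; [_,_]′)
open import Data.Sum.Function.Propositional using (_⊎-↔_)
open import Data.Sum.Properties using (inj₁-injective; inj₂-injective)
open import Data.Vec using (Vec; []; _∷_; lookup; tabulate)
import Data.Vec as Vec
open import Data.Vec.Properties using (lookup∘tabulate)
open import Function using (_∘_; case_of_; Equivalence)
open import Function.Bundles using (_↔_; Injection; mk↣)
open import Function.Construct.Composition using (_↣-∘_; _↔-∘_)
open import Function.Definitions using (Injective)
open import Function.Properties.Inverse using (↔-refl; ↔-sym; ↔⇒↣)
open import Relation.Binary.PropositionalEquality
  using (_≡_; _≢_; refl; sym; trans; cong; cong₂; subst; subst₂; ≢-sym; module ≡-Reasoning)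
open import Relation.Nullary using (¬_; Dec; yes; no; contradiction)
open import Relation.Nullary.Decidable
  using (map′; ¬?; _×-dec_; _⊎-dec_; _→-dec_; decidable-stable; True; toWitness; from-yes)

-- Finite search over vertices and colorings

vertex-≡ : ∀ {n} {u v : KVertex n} → proj₁ u ≡ proj₁ v → u ≡ v
vertex-≡ {u = _ , p} {_ , q} refl = cong (_ ,_) (Fin.<-irrelevant p q)

anyVertex? : ∀ {n} {P : KVertex n → Set} → (∀ v → Dec (P v)) → Dec (∃ P)
anyVertex? {n} {P} P? =
  map′ (λ (i , j , i<j , p) → ((i , j) , i<j) , p) (λ (((i , j) , i<j) , p) → i , j , i<j , p)
    (Fin.any? λ i → Fin.any? λ j → anyProof? i j)
  where
  anyProof? : ∀ i j → Dec (∃ λ (i<j : i Fin.< j) → P ((i , j) , i<j))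
  anyProof? i j with i Fin.<? j
  -- Any two proofs of `i < j` are equal, so testing `P` at one of them decides the question for the
  -- pair.
  ... | yes i<j = map′ (i<j ,_) (λ (_ , p) → subst P (vertex-≡ refl) p) (P? _)
  ... | no  i≮j = no (i≮j ∘ proj₁)

allVertices? : ∀ {n} {P : KVertex n → Set} → (∀ v → Dec (P v)) → Dec (∀ v → P v)
allVertices? P? =
  map′ (λ ∄¬p v → decidable-stable (P? v) (λ ¬p → ∄¬p (v , ¬p))) (λ ∀p (v , ¬p) → ¬p (∀p v))
    (¬? (anyVertex? (¬? ∘ P?)))

_≟ⱽ_ : ∀ {n} (u v : KVertex n) → Dec (u ≡ v)
((i , j) , _) ≟ⱽ ((k , l) , _) =
  map′ (λ { (refl , refl) → vertex-≡ refl }) (λ { refl → refl , refl }) ((i Fin.≟ k) ×-dec (j Fin.≟ l))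

disjoint? : ∀ {n} (u v : KVertex n) → Dec (Disjoint₂ u v)
disjoint? ((i , j) , _) ((k , l) , _) =
  ¬? (i Fin.≟ k) ×-dec ¬? (i Fin.≟ l) ×-dec ¬? (j Fin.≟ k) ×-dec ¬? (j Fin.≟ l)

disjoint-sym : ∀ {n} (u v : KVertex n) → Disjoint₂ u v → Disjoint₂ v u
disjoint-sym u v (p , q , r , s) = ≢-sym p , ≢-sym r , ≢-sym q , ≢-sym s

module _ {n l : ℕ} (c : KVertex n → Fin l) where

  surjective? : Dec (Surjective c)
  surjective? = Fin.all? λ a → anyVertex? λ v → c v Fin.≟ a

  complete? : Dec (IsComplete (Kneser2 n) c)
  complete? = Fin.all? λ a → Fin.all? λ b → ¬? (a Fin.≟ b) →-dec
    anyVertex? λ u → anyVertex? λ v → disjoint? u v ×-dec (c u Fin.≟ a) ×-dec (c v Fin.≟ b)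

  proper? : Dec (IsProper (Kneser2 n) c)
  proper? = allVertices? λ u → allVertices? λ v → disjoint? u v →-dec ¬? (c u Fin.≟ c v)

module _ {n l : ℕ} {c d : KVertex n → Fin l} (c≗d : ∀ v → c v ≡ d v) where

  surjective-resp : Surjective c → Surjective d
  surjective-resp sur a with v , cv≡a ← sur a = v , trans (sym (c≗d v)) cv≡a

  complete-resp : IsComplete (Kneser2 n) c → IsComplete (Kneser2 n) d
  complete-resp com a b a≢b with u , v , adj , cu≡a , cv≡b ← com a b a≢b =
    u , v , adj , trans (sym (c≗d u)) cu≡a , trans (sym (c≗d v)) cv≡b

-- Enumerating colorings by tables of colors

anyVec? : {A : Set} → (∀ {P : A → Set} → (∀ x → Dec (P x)) → Dec (∃ P)) →
  ∀ n {P : Vec A n → Set} → (∀ xs → Dec (P xs)) → Dec (∃ P)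
anyVec? any zero    P? = map′ ([] ,_) (λ { ([] , p) → p }) (P? [])
anyVec? any (suc n) P? =
  map′ (λ (x , xs , p) → x ∷ xs , p) (λ { (x ∷ xs , p) → x , xs , p })
    (any λ x → anyVec? any n λ xs → P? (x ∷ xs))

-- The recursion splits off the `n` edges at vertex 0, exactly as `rank` does.
triangle : ℕ → ℕ
triangle zero    = 0
triangle (suc n) = n + triangle n

triangle≡C : ∀ n → triangle n ≡ n C 2
triangle≡C zero    = refl
triangle≡C (suc n) = begin
  n + triangle n   ≡⟨ cong₂ _+_ (sym (nC1≡n n)) (triangle≡C n) ⟩
  n C 1 + n C 2    ≡⟨ nCk+nC[k+1]≡[n+1]C[k+1] n 1 ⟩
  suc n C 2        ∎
  where open ≡-Reasoning

-- Lexicographic; tables of colors are listed in this order.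
rank : ∀ {n} → KVertex n → Fin (triangle n)
rank {suc n} ((zero  , suc j) , _)     = j ↑ˡ triangle n
rank {suc n} ((suc i , suc j) , s≤s p) = n ↑ʳ rank ((i , j) , p)

rank-injective : ∀ {n} → Injective _≡_ _≡_ (rank {n})
rank-injective {suc n} {(zero , suc j) , s≤s z≤n} {(zero , suc l) , s≤s z≤n} eq
  with refl ← Fin.↑ˡ-injective (triangle n) j l eq = refl
rank-injective {suc n} {(zero , suc j) , _} {(suc k , suc l) , s≤s q} eq =
  case trans (sym (Fin.splitAt-↑ˡ n j (triangle n)))
    (trans (cong (splitAt n) eq) (Fin.splitAt-↑ʳ n (triangle n) (rank ((k , l) , q)))) of λ ()
rank-injective {suc n} {(suc i , suc j) , s≤s p} {(zero , suc l) , _} eq =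
  case trans (sym (Fin.splitAt-↑ˡ n l (triangle n)))
    (trans (cong (splitAt n) (sym eq)) (Fin.splitAt-↑ʳ n (triangle n) (rank ((i , j) , p)))) of λ ()
rank-injective {suc n} {(suc i , suc j) , s≤s p} {(suc k , suc l) , s≤s q} eq
  with refl ← rank-injective {n} {(i , j) , p} {(k , l) , q} (Fin.↑ʳ-injective n _ _ eq) = refl

fromTable : ∀ {n l} → Vec (Fin l) (triangle n) → KVertex n → Fin l
fromTable t = lookup t ∘ rank

colorAt : ∀ {n l k} → (KVertex n → Fin (suc l)) → Dec (∃[ v ] rank v ≡ k) → Fin (suc l)
colorAt c (yes (v , _)) = c v
-- The default `zero` would fill an entry that is the rank of no vertex, which `fromTable` never
-- reads. It is the reason for colors in `Fin (suc l)`.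
colorAt c (no  _)       = zero

colorAt-rank : ∀ {n l} (c : KVertex n → Fin (suc l)) v d → colorAt {k = rank v} c d ≡ c v
colorAt-rank c v (yes (_ , eq)) = cong c (rank-injective eq)
colorAt-rank c v (no ∄)         = contradiction (v , refl) ∄

toTable : ∀ {n l} → (KVertex n → Fin (suc l)) → Vec (Fin (suc l)) (triangle n)
toTable c = tabulate λ k → colorAt c (anyVertex? λ v → rank v Fin.≟ k)

fromTable∘toTable : ∀ {n l} (c : KVertex n → Fin (suc l)) v → fromTable (toTable c) v ≡ c v
fromTable∘toTable c v = trans (lookup∘tabulate _ (rank v))
  (colorAt-rank c v (anyVertex? λ u → rank u Fin.≟ rank v))

-- Functions cannot be listed, but tables can. A coloring agrees pointwise with the one read from
-- its table, and surjectivity and completeness depend only on the values.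
hasCompleteColoring? : ∀ n l → Dec (HasCompleteColoring (Kneser2 n) (suc l))
hasCompleteColoring? n l =
  map′ (λ (t , sc) → fromTable t , sc)
    (λ (c , sur , com) → let c≗t = λ v → sym (fromTable∘toTable c v) in
       toTable c , surjective-resp c≗t sur , complete-resp c≗t com)
    (anyVec? Fin.any? (triangle n) λ t → surjective? (fromTable t) ×-dec complete? (fromTable t))

-- Upper bounds

Fin-≤ : ∀ {A B : Set} {m n} → Fin m ↔ A → Fin n ↔ B → {f : A → B} → Injective _≡_ _≡_ f → m ≤ n
Fin-≤ Fm↔A Fn↔B inj =
  Fin.injective⇒≤ (Injection.injective (↔⇒↣ (↔-sym Fn↔B) ↣-∘ (mk↣ inj ↣-∘ ↔⇒↣ Fm↔A)))

endpoint : ∀ {n} → KVertex n → Fin 2 → Fin n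
endpoint ((i , j) , _) zero    = i
endpoint ((i , j) , _) (suc _) = j

endpoint-injective : ∀ {n} (v : KVertex n) {b b′} → endpoint v b ≡ endpoint v b′ → b ≡ b′
endpoint-injective v       {zero}     {zero}     _    = refl
endpoint-injective (_ , p) {zero}     {suc zero} refl = contradiction p (ℕ.<-irrefl refl)
endpoint-injective (_ , p) {suc zero} {zero}     refl = contradiction p (ℕ.<-irrefl refl)
endpoint-injective v       {suc zero} {suc zero} _    = refl

disjoint⇒endpoint≢ : ∀ {n} (u v : KVertex n) → Disjoint₂ u v → ∀ b b′ → endpoint u b ≢ endpoint v b′
disjoint⇒endpoint≢ u v (p , _ , _ , _) zero    zero    = p
disjoint⇒endpoint≢ u v (_ , q , _ , _) zero    (suc _) = q
disjoint⇒endpoint≢ u v (_ , _ , r , _) (suc _) zero    = r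
disjoint⇒endpoint≢ u v (_ , _ , _ , s) (suc _) (suc _) = s

module _ {n l : ℕ} {c : KVertex n → Fin l} (sur : Surjective c) (com : IsComplete (Kneser2 n) c) where

  rep : Fin l → KVertex n
  rep a = proj₁ (sur a)

  -- Its negation says that the class of `a` is a singleton.
  Second : Fin l → Set
  Second a = ∃[ v ] (v ≢ rep a × c v ≡ a)

  second? : ∀ a → Dec (Second a)
  second? a = anyVertex? λ v → ¬? (v ≟ⱽ rep a) ×-dec (c v Fin.≟ a)

  singleton-unique : ∀ {a} → ¬ Second a → ∀ v → c v ≡ a → v ≡ rep a
  singleton-unique {a} ∄ v cv≡a = decidable-stable (v ≟ⱽ rep a) λ v≢ → ∄ (v , v≢ , cv≡a)

  -- Completeness supplies adjacent vertices of colors `a` and `b`, and in singleton classes these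
  -- can only be the representatives.
  singletons-disjoint : ∀ {a b} → ¬ Second a → ¬ Second b → a ≢ b → Disjoint₂ (rep a) (rep b)
  singletons-disjoint {a} {b} ∄a ∄b a≢b with u , v , adj , cu≡a , cv≡b ← com a b a≢b
    with refl ← singleton-unique ∄a u cu≡a | refl ← singleton-unique ∄b v cv≡b = adj

  -- With s singleton classes one has 2l ≤ |V| + s and 2s ≤ n. Taking every vertex twice merges both
  -- into 4l ≤ 2|V| + n, so that s need not be counted.
  Target : Set
  Target = (Fin 2 × Fin (triangle n)) ⊎ Fin n

  extra : ∀ {a} → Dec (Second a) → Fin 2 → Target
  extra     (yes (v , _)) b = inj₁ (b , rank v)
  extra {a} (no  _)       b = inj₂ (endpoint (rep a) b)

  -- A second vertex determines its color, and singleton classes are disjoint edges, so no two of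
  -- them share an endpoint.
  extra-injective : ∀ {a a′} (d : Dec (Second a)) (d′ : Dec (Second a′)) {b b′} →
    extra d b ≡ extra d′ b′ → a ≡ a′ × b ≡ b′
  extra-injective (yes (v , _ , cv≡a)) (yes (v′ , _ , cv′≡a′)) eq
    with b≡b′ , rv≡rv′ ← ,-injective (inj₁-injective eq) =
    trans (sym cv≡a) (trans (cong c (rank-injective rv≡rv′)) cv′≡a′) , b≡b′
  extra-injective {a} {a′} (no ∄) (no ∄′) {b} {b′} eq with a Fin.≟ a′
  ... | yes refl = refl , endpoint-injective (rep a) (inj₂-injective eq)
  ... | no  a≢a′ = contradiction (inj₂-injective eq)
    (disjoint⇒endpoint≢ (rep a) (rep a′) (singletons-disjoint ∄ ∄′ a≢a′) b b′)

  -- Each color claims two vertices, doubled; a singleton class claims the two endpoints of its edge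
  -- in place of the missing vertex.
  spread : Fin l × Fin 2 × Fin 2 → Target
  spread (a , zero  , b) = inj₁ (b , rank (rep a))
  spread (a , suc _ , b) = extra (second? a) b

  rep≢extra : ∀ {a a′} (d : Dec (Second a′)) {b b′} → inj₁ (b , rank (rep a)) ≢ extra d b′
  rep≢extra {a} {a′} (yes (v , v≢ , cv≡a′)) eq = v≢ (trans (sym rep≡v) (cong rep a≡a′))
    where
    rep≡v : rep a ≡ v
    rep≡v = rank-injective (,-injectiveʳ (inj₁-injective eq))
    a≡a′ : a ≡ a′
    a≡a′ = trans (sym (proj₂ (sur a))) (trans (cong c rep≡v) cv≡a′)

  rep-injective : ∀ {a a′} → rep a ≡ rep a′ → a ≡ a′
  rep-injective {a} {a′} eq = trans (sym (proj₂ (sur a))) (trans (cong c eq) (proj₂ (sur a′)))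

  spread-injective : Injective _≡_ _≡_ spread
  spread-injective {a , zero , b} {a′ , zero , b′} eq
    with refl , r≡r′ ← ,-injective (inj₁-injective eq) =
    cong (_, _) (rep-injective (rank-injective r≡r′))
  spread-injective {a , zero , b} {a′ , suc _ , b′} eq = contradiction eq (rep≢extra (second? a′))
  spread-injective {a , suc _ , b} {a′ , zero , b′} eq = contradiction (sym eq) (rep≢extra (second? a))
  spread-injective {a , suc zero , b} {a′ , suc zero , b′} eq
    with refl , refl ← extra-injective (second? a) (second? a′) eq = refl

  l*4≤2|V|+n : l * (2 * 2) ≤ 2 * triangle n + n
  l*4≤2|V|+n = Fin-≤ ((↔-refl ×-↔ Fin.*↔×) ↔-∘ Fin.*↔×) ((Fin.*↔× ⊎-↔ ↔-refl) ↔-∘ Fin.+↔⊎) spread-injective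

  no-singletons⇒l*2≤|V| : (∀ a → Second a) → l * 2 ≤ triangle n
  no-singletons⇒l*2≤|V| second = Fin-≤ Fin.*↔× ↔-refl {f = slot} slot-injective
    where
    slot : Fin l × Fin 2 → Fin (triangle n)
    slot (a , zero)  = rank (rep a)
    slot (a , suc _) = rank (proj₁ (second a))
    color-slot : ∀ p {v} → slot p ≡ rank v → c v ≡ proj₁ p
    color-slot (a , zero)  eq = trans (cong c (sym (rank-injective eq))) (proj₂ (sur a))
    color-slot (a , suc _) eq = trans (cong c (sym (rank-injective eq))) (proj₂ (proj₂ (second a)))
    slot-injective : Injective _≡_ _≡_ slot
    slot-injective {a , zero} {a′ , zero} eq with refl ← rep-injective (rank-injective eq) = refl
    slot-injective {a , zero} {a′ , suc _} eq
      with refl ← trans (sym (color-slot (a , zero) eq)) (proj₂ (proj₂ (second a′))) =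
      contradiction (sym (rank-injective eq)) (proj₁ (proj₂ (second a)))
    slot-injective {a , suc _} {a′ , zero} eq
      with refl ← trans (sym (color-slot (a , suc zero) eq)) (proj₂ (sur a′)) =
      contradiction (rank-injective eq) (proj₁ (proj₂ (second a)))
    slot-injective {a , suc zero} {a′ , suc zero} eq
      with refl ← trans (sym (color-slot (a , suc zero) eq)) (proj₂ (proj₂ (second a′))) = refl

-- Deleting the two endpoints of an edge

<-punchOut : ∀ {n} {i j k : Fin (suc n)} (i≢j : i ≢ j) (i≢k : i ≢ k) → j Fin.< k →
  punchOut i≢j Fin.< punchOut i≢k
<-punchOut i≢j i≢k j<k = Fin.≤∧≢⇒< (Fin.punchOut-mono-≤ i≢j i≢k (ℕ.<⇒≤ j<k))
  (Fin.<⇒≢ j<k ∘ Fin.punchOut-injective i≢j i≢k)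

punchOut-≢ : ∀ {n} {i j k : Fin (suc n)} (j≢i : j ≢ i) → i ≢ k → (j≢k : j ≢ k) → punchOut j≢i ≢ punchOut j≢k
punchOut-≢ j≢i i≢k j≢k = i≢k ∘ Fin.punchOut-injective j≢i j≢k

punchOut₂ : ∀ {n} {i j k : Fin (2 + n)} → j ≢ i → i ≢ k → j ≢ k → Fin n
punchOut₂ j≢i i≢k j≢k = punchOut (punchOut-≢ j≢i i≢k j≢k)

punchOut₂-injective : ∀ {n} {i j k l : Fin (2 + n)} (j≢i : j ≢ i)
  (i≢k : i ≢ k) (j≢k : j ≢ k) (i≢l : i ≢ l) (j≢l : j ≢ l) →
  punchOut₂ j≢i i≢k j≢k ≡ punchOut₂ j≢i i≢l j≢l → k ≡ l
punchOut₂-injective j≢i i≢k j≢k i≢l j≢l =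
  Fin.punchOut-injective j≢k j≢l ∘ Fin.punchOut-injective (punchOut-≢ j≢i i≢k j≢k) (punchOut-≢ j≢i i≢l j≢l)

-- An edge disjoint from `u` lives on the remaining `n` points; renumbering them preserves order, so
-- the result is again an increasing pair.
restrict : ∀ {n} (u v : KVertex (2 + n)) → Disjoint₂ u v → KVertex n
restrict ((i , j) , i<j) ((k , l) , k<l) (i≢k , i≢l , j≢k , j≢l) =
  (punchOut₂ j≢i i≢k j≢k , punchOut₂ j≢i i≢l j≢l) ,
  <-punchOut (punchOut-≢ j≢i i≢k j≢k) (punchOut-≢ j≢i i≢l j≢l) (<-punchOut j≢k j≢l k<l)
  where j≢i = ≢-sym (Fin.<⇒≢ i<j)

restrict-injective : ∀ {n} (u : KVertex (2 + n)) {v w} (u∥v : Disjoint₂ u v) (u∥w : Disjoint₂ u w) →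
  restrict u v u∥v ≡ restrict u w u∥w → v ≡ w
restrict-injective (_ , i<j) (i≢k , i≢l , j≢k , j≢l) (i≢k′ , i≢l′ , j≢k′ , j≢l′) eq = vertex-≡ (cong₂ _,_
  (punchOut₂-injective j≢i i≢k j≢k i≢k′ j≢k′ (cong (proj₁ ∘ proj₁) eq))
  (punchOut₂-injective j≢i i≢l j≢l i≢l′ j≢l′ (cong (proj₂ ∘ proj₁) eq)))
  where j≢i = ≢-sym (Fin.<⇒≢ i<j)

-- Every color other than `a`, listed by `punchIn a`, must occur on an edge disjoint from `u`, and
-- these edges embed into the pairs of the `n` remaining points.
singleton⇒≤ : ∀ {n l} {c : KVertex (2 + n) → Fin (suc l)} → IsComplete (Kneser2 (2 + n)) c →
  ∀ {a u} → (∀ v → c v ≡ a → v ≡ u) → l ≤ triangle n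
singleton⇒≤ {n} {l} {c} com {a} {u} unique =
  Fin.injective⇒≤ {f = rank ∘ shrink} λ eq → shrink-injective (rank-injective eq)
  where
  neighbor : ∀ b → ∃[ v ] (Disjoint₂ u v × c v ≡ punchIn a b)
  neighbor b with x , y , adj , cx≡a , cy≡b ← com a (punchIn a b) (≢-sym (Fin.punchInᵢ≢i a b))
    with refl ← unique x cx≡a = y , adj , cy≡b
  shrink : Fin l → KVertex n
  shrink b = restrict u (proj₁ (neighbor b)) (proj₁ (proj₂ (neighbor b)))
  shrink-injective : Injective _≡_ _≡_ shrink
  shrink-injective {b} {b′} eq = Fin.punchIn-injective a b b′ (trans (sym (proj₂ (proj₂ (neighbor b)))) (trans
    (cong c (restrict-injective u (proj₁ (proj₂ (neighbor b))) (proj₁ (proj₂ (neighbor b′))) eq))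
    (proj₂ (proj₂ (neighbor b′)))))

-- Either no class is a singleton, or the neighbors of a singleton limit the colors. On 3 to 6
-- points this is sharper than `upperBound`.
pairs⊎star : ∀ {n l} → HasCompleteColoring (Kneser2 (2 + n)) l →
  l * 2 ≤ triangle (2 + n) ⊎ l ≤ suc (triangle n)
pairs⊎star {n} {zero}  _ = inj₁ z≤n
pairs⊎star {n} {suc l} (c , sur , com) with Fin.all? (second? sur com)
... | yes second = inj₁ (no-singletons⇒l*2≤|V| sur com second)
... | no ¬second with a , ∄ ← Fin.¬∀⟶∃¬ _ _ (second? sur com) ¬second =
  inj₂ (s≤s (singleton⇒≤ com (singleton-unique sur com ∄)))

complete⇒≤upperBound : ∀ n l → HasCompleteColoring (Kneser2 n) l → l ≤ upperBound n
complete⇒≤upperBound n l (_ , sur , com) = begin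
  l                                ≡⟨ m*n/n≡m l 2 ⟨
  l * 2 / 2                        ≤⟨ /-monoˡ-≤ 2 (ℕ.≮⇒≥ absurd) ⟩
  (triangle n + n / 2) / 2         ≡⟨ cong (λ t → (t + n / 2) / 2) (triangle≡C n) ⟩
  upperBound n                     ∎
  where
  open ℕ.≤-Reasoning
  -- Passes from 4l ≤ 2t + n to 2l ≤ t + ⌊n/2⌋, where t is `triangle n`: otherwise 2(t + ⌊n/2⌋ + 1)
  -- ≤ 4l, while n < 2⌊n/2⌋ + 2.
  absurd : ¬ (triangle n + n / 2 < l * 2)
  absurd lt = ℕ.<-irrefl refl (begin-strict
    2 * triangle n + n                             ≡⟨ cong (2 * triangle n +_) (m≡m%n+[m/n]*n n 2) ⟩
    2 * triangle n + (n % 2 + n / 2 * 2)           <⟨ ℕ.+-monoʳ-< (2 * triangle n) (ℕ.+-monoˡ-< (n / 2 * 2) (m%n<n n 2)) ⟩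
    2 * triangle n + (2 + n / 2 * 2)               ≡⟨ arith (triangle n) (n / 2) ⟩
    suc (triangle n + n / 2) * 2                   ≤⟨ ℕ.*-monoˡ-≤ 2 lt ⟩
    l * 2 * 2                                      ≡⟨ ℕ.*-assoc l 2 2 ⟩
    l * (2 * 2)                                    ≤⟨ l*4≤2|V|+n sur com ⟩
    2 * triangle n + n                             ∎)
    where
    arith : ∀ t h → 2 * t + (2 + h * 2) ≡ suc (t + h) * 2
    arith = solve-∀

-- Complete colorings of the extremal size

Edge : Set
Edge = ℕ × ℕ

-- A singleton color class {e} is encoded as (e , e).
Class : Set
Class = Edge × Edge

_≠ᵇ_ : ℕ → ℕ → Bool
m ≠ᵇ n = not (m ≡ᵇ n)

-- Distinct, Apart and Misses are decided by booleans so that instances involving only the new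
-- vertices 0, 1, 2, 3 of the step n ↦ 4 + n hold by computation.
Distinct : Edge → Edge → Set
Distinct (a , b) (c , d) = T (not ((a ≡ᵇ c) ∧ (b ≡ᵇ d)))

Apart : Edge → Edge → Set
Apart (a , b) (c , d) = T ((a ≠ᵇ c) ∧ (a ≠ᵇ d) ∧ (b ≠ᵇ c) ∧ (b ≠ᵇ d))

Misses : ℕ → Edge → Set
Misses i (a , b) = T ((i ≠ᵇ a) ∧ (i ≠ᵇ b))

Compatible : Class → Class → Set
Compatible (e , f) (g , h) =
  (Distinct e g × Distinct e h × Distinct f g × Distinct f h) ×
  (Apart e g ⊎ Apart e h ⊎ Apart f g ⊎ Apart f h)

Valid : ℕ → Edge → Set
Valid n (a , b) = a < b × b < n

-- Not an edge of the cycle 0, 1, …, n − 1.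
Chord : ℕ → Edge → Set
Chord n (a , b) = T (b ≠ᵇ suc a) × T (not ((a ≡ᵇ 0) ∧ (suc b ≡ᵇ n)))

-- For each i the class then has an edge other than {i, σ(i)}, which keeps it adjacent to the new
-- classes `P i` and `Q i`. The alternative `Chord` serves the singletons.
Admissible : ℕ → Class → Set
Admissible n (e , f) = (Valid n e × Valid n f) × (Distinct e f ⊎ Chord n e)

-- The classes `first` and `second` are the ones dissolved by the step n ↦ 4 + n.
record Family (n l : ℕ) : Set where
  field
    first second : Class
    others       : List Class
    compatible   : AllPairs Compatible (first ∷ second ∷ others)
    admissible   : All (Admissible n) (first ∷ second ∷ others)
    first-chords : Chord n (proj₁ first) × Chord n (proj₂ first)
    first-pair   : Distinct (proj₁ first) (proj₂ first)
    second-pair  : Distinct (proj₁ second) (proj₂ second)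
    size         : 2 + length others ≡ l

distinct? : ∀ e f → Dec (Distinct e f)
distinct? e f = T? _

apart? : ∀ e f → Dec (Apart e f)
apart? e f = T? _

compatible? : ∀ A B → Dec (Compatible A B)
compatible? (e , f) (g , h) =
  (distinct? e g ×-dec distinct? e h ×-dec distinct? f g ×-dec distinct? f h) ×-dec
  (apart? e g ⊎-dec apart? e h ⊎-dec apart? f g ⊎-dec apart? f h)

valid? : ∀ n e → Dec (Valid n e)
valid? n (a , b) = (a ℕ.<? b) ×-dec (b ℕ.<? n)

chord? : ∀ n e → Dec (Chord n e)
chord? n e = T? _ ×-dec T? _

admissible? : ∀ n A → Dec (Admissible n A)
admissible? n (e , f) = (valid? n e ×-dec valid? n f) ×-dec (distinct? e f ⊎-dec chord? n e)

checkedFamily : ∀ n A B Cs →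
  {True (allPairs? compatible? (A ∷ B ∷ Cs))} → {True (all? (admissible? n) (A ∷ B ∷ Cs))} →
  {True (chord? n (proj₁ A) ×-dec chord? n (proj₂ A))} →
  {True (distinct? (proj₁ A) (proj₂ A))} → {True (distinct? (proj₁ B) (proj₂ B))} →
  Family n (2 + length Cs)
checkedFamily n A B Cs {com} {adm} {ch} {fst≢} {snd≢} = record
  { first = A ; second = B ; others = Cs
  ; compatible = toWitness com ; admissible = toWitness adm ; first-chords = toWitness ch
  ; first-pair = toWitness fst≢ ; second-pair = toWitness snd≢ ; size = refl
  }

-- From a family to a coloring

∧-intro : ∀ {x y} → T x → T y → T (x ∧ y)
∧-intro p q = Equivalence.from T-∧ (p , q)

∧-elim : ∀ {x y} → T (x ∧ y) → T x × T y
∧-elim = Equivalence.to T-∧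

T-not : ∀ {x} → ¬ T x → T (not x)
T-not {true}  ¬t = ¬t _
T-not {false} _  = _

¬T-not : ∀ {x} → T (not x) → ¬ T x
¬T-not {false} _ ()

≠ᵇ-intro : ∀ {m n} → m ≢ n → T (m ≠ᵇ n)
≠ᵇ-intro {m} {n} m≢n = T-not (m≢n ∘ ℕ.≡ᵇ⇒≡ m n)

≠ᵇ-elim : ∀ {m n} → T (m ≠ᵇ n) → m ≢ n
≠ᵇ-elim {m} {n} t = ¬T-not t ∘ ℕ.≡⇒≡ᵇ m n

distinct-irrefl : ∀ e → ¬ Distinct e e
distinct-irrefl (a , b) d = ¬T-not d (∧-intro (ℕ.≡⇒≡ᵇ a a refl) (ℕ.≡⇒≡ᵇ b b refl))

_∈ᶜ_ : Edge → Class → Set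
e ∈ᶜ (f , g) = e ≡ f ⊎ e ≡ g

_∈ᶜ?_ : ∀ e A → Dec (e ∈ᶜ A)
e ∈ᶜ? (f , g) = ≡-dec ℕ._≟_ ℕ._≟_ e f ⊎-dec ≡-dec ℕ._≟_ ℕ._≟_ e g

compatible⇒no-common : ∀ {A B e} → Compatible A B → e ∈ᶜ A → ¬ e ∈ᶜ B
compatible⇒no-common {e = e} ((d , _ , _ , _) , _) (inj₁ refl) (inj₁ refl) = distinct-irrefl e d
compatible⇒no-common {e = e} ((_ , d , _ , _) , _) (inj₁ refl) (inj₂ refl) = distinct-irrefl e d
compatible⇒no-common {e = e} ((_ , _ , d , _) , _) (inj₂ refl) (inj₁ refl) = distinct-irrefl e d
compatible⇒no-common {e = e} ((_ , _ , _ , d) , _) (inj₂ refl) (inj₂ refl) = distinct-irrefl e d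

compatible⇒apart : ∀ {A B} → Compatible A B → ∃[ e ] ∃[ f ] (e ∈ᶜ A × f ∈ᶜ B × Apart e f)
compatible⇒apart (_ , inj₁ p)               = _ , _ , inj₁ refl , inj₁ refl , p
compatible⇒apart (_ , inj₂ (inj₁ p))        = _ , _ , inj₁ refl , inj₂ refl , p
compatible⇒apart (_ , inj₂ (inj₂ (inj₁ p))) = _ , _ , inj₂ refl , inj₁ refl , p
compatible⇒apart (_ , inj₂ (inj₂ (inj₂ p))) = _ , _ , inj₂ refl , inj₂ refl , p

allPairs-lookup : ∀ {A : Set} {R : A → A → Set} {xs} → AllPairs R xs → ∀ {i j} → i ≢ j →
  R (List.lookup xs i) (List.lookup xs j) ⊎ R (List.lookup xs j) (List.lookup xs i)
allPairs-lookup (r ∷ rs) {zero}  {zero}  i≢j = contradiction refl i≢j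
allPairs-lookup (r ∷ rs) {zero}  {suc j} i≢j = inj₁ (All.lookup r (∈-lookup j))
allPairs-lookup (r ∷ rs) {suc i} {zero}  i≢j = inj₂ (All.lookup r (∈-lookup i))
allPairs-lookup (r ∷ rs) {suc i} {suc j} i≢j = allPairs-lookup rs (i≢j ∘ cong suc)

edge : ∀ {n} → KVertex n → Edge
edge ((i , j) , _) = toℕ i , toℕ j

vertex : ∀ {n e} → Valid n e → ∃[ v ] edge {n} v ≡ e
vertex {n} {a , b} (a<b , b<n) =
  ((fromℕ< a<n , fromℕ< b<n) , subst₂ _<_ (sym (Fin.toℕ-fromℕ< a<n)) (sym (Fin.toℕ-fromℕ< b<n)) a<b) ,
  cong₂ _,_ (Fin.toℕ-fromℕ< a<n) (Fin.toℕ-fromℕ< b<n)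
  where a<n = ℕ.<-trans a<b b<n

apart⇒disjoint : ∀ {n} (u v : KVertex n) → Apart (edge u) (edge v) → Disjoint₂ u v
apart⇒disjoint u v p with t₁ , p ← ∧-elim p with t₂ , p ← ∧-elim p with t₃ , t₄ ← ∧-elim p =
  ≠ᵇ-elim t₁ ∘ cong toℕ , ≠ᵇ-elim t₂ ∘ cong toℕ , ≠ᵇ-elim t₃ ∘ cong toℕ , ≠ᵇ-elim t₄ ∘ cong toℕ

module _ {n : ℕ} {A : Class} {Cs : List Class}
  (com : AllPairs Compatible (A ∷ Cs)) (valid : All (λ (e , f) → Valid n e × Valid n f) (A ∷ Cs)) where

  private
    L = A ∷ Cs

  -- Edges outside all the classes get color 0.
  classIndex : ∀ {e} → Dec (Any (e ∈ᶜ_) L) → Fin (length L)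
  classIndex (yes p) = Any.index p
  classIndex (no  _) = zero

  -- Compatible classes share no edge, so whichever index the search finds is the only one.
  classIndex-correct : ∀ {e} (d : Dec (Any (e ∈ᶜ_) L)) k → e ∈ᶜ List.lookup L k → classIndex d ≡ k
  classIndex-correct (no ∉) k e∈ = contradiction (lose (∈-lookup k) e∈) ∉
  classIndex-correct (yes p) k e∈ with Any.index p Fin.≟ k
  ... | yes eq = eq
  ... | no  ≢k with allPairs-lookup com ≢k
  ...   | inj₁ r = contradiction e∈ (compatible⇒no-common r (lookup-index p))
  ...   | inj₂ r = contradiction (lookup-index p) (compatible⇒no-common r e∈)

  classColor : KVertex n → Fin (length L)
  classColor v = classIndex (Any.any? (edge v ∈ᶜ?_) L)

  class-valid : ∀ k {e} → e ∈ᶜ List.lookup L k → Valid n e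
  class-valid k (inj₁ refl) = proj₁ (All.lookup valid (∈-lookup {xs = L} k))
  class-valid k (inj₂ refl) = proj₂ (All.lookup valid (∈-lookup {xs = L} k))

  classVertex : ∀ k {e} → e ∈ᶜ List.lookup L k → ∃[ v ] (edge v ≡ e × classColor v ≡ k)
  classVertex k e∈ with v , refl ← vertex (class-valid k e∈) =
    v , refl , classIndex-correct (Any.any? (edge v ∈ᶜ?_) L) k e∈

  classColor-surjective : Surjective classColor
  classColor-surjective k with v , _ , eq ← classVertex k (inj₁ refl) = v , eq

  compatible⇒adjacent : ∀ a b → Compatible (List.lookup L a) (List.lookup L b) →
    ∃[ u ] ∃[ v ] (Disjoint₂ u v × classColor u ≡ a × classColor v ≡ b)
  compatible⇒adjacent a b r with _ , _ , e∈ , f∈ , apart ← compatible⇒apart r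
    with u , refl , cu≡a ← classVertex a e∈ | v , refl , cv≡b ← classVertex b f∈ =
    u , v , apart⇒disjoint u v apart , cu≡a , cv≡b

  classColor-complete : IsComplete (Kneser2 n) classColor
  classColor-complete a b a≢b with allPairs-lookup com a≢b
  ... | inj₁ r = compatible⇒adjacent a b r
  ... | inj₂ r with v , u , adj , cv≡b , cu≡a ← compatible⇒adjacent b a r =
    u , v , disjoint-sym v u adj , cu≡a , cv≡b

family⇒coloring : ∀ {n l} → Family n l → HasCompleteColoring (Kneser2 n) l
family⇒coloring record { compatible = com ; admissible = adm ; size = refl } =
  _ , classColor-surjective com valid , classColor-complete com valid
  where valid = All.map proj₁ adm

-- The step n ↦ 4 + n

-- The cyclic shift σ of 0, ..., n - 1.
next : ℕ → ℕ → ℕ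
next n i with suc i ℕ.≟ n
... | yes _ = 0
... | no  _ = suc i

-- The graph of σ as a view, so that later proofs match on `wrap` and `step` instead of repeating
-- the comparison.
data Next (n i : ℕ) : ℕ → Set where
  wrap : suc i ≡ n → Next n i 0
  step : suc i ≢ n → Next n i (suc i)

next-view : ∀ n i → Next n i (next n i)
next-view n i with suc i ℕ.≟ n
... | yes eq = wrap eq
... | no  ≢n = step ≢n

Next-< : ∀ {n i j} → i < n → Next n i j → j < n
Next-< i<n (wrap refl) = s≤s z≤n
Next-< i<n (step ≢n)   = ℕ.≤∧≢⇒< i<n ≢n

Next-injective : ∀ {n i i′ j} → Next n i j → Next n i′ j → i ≡ i′
Next-injective (wrap refl) (wrap refl) = refl
Next-injective (step _)    (step _)    = refl

Next-irrefl : ∀ {n i j} → 2 ≤ n → Next n i j → i ≢ j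
Next-irrefl (s≤s ()) (wrap refl) refl
Next-irrefl 2≤n (step _) ()

-- Two wraps would force n = 1, a wrap with a step n = 2, and two steps only increase.
Next-asym : ∀ {n i j} → 3 ≤ n → Next n i j → ¬ Next n j i
Next-asym (s≤s ()) (wrap refl) (wrap refl)
Next-asym (s≤s (s≤s ())) (wrap refl) (step _)
Next-asym (s≤s (s≤s ())) (step _) (wrap refl)

-- Edges that avoid i or σ(i)

misses⊎hits : ∀ i ((a , b) : Edge) → Misses i (a , b) ⊎ (i ≡ a ⊎ i ≡ b)
misses⊎hits i (a , b) with i ℕ.≟ a | i ℕ.≟ b
... | yes i≡a | _       = inj₂ (inj₁ i≡a)
... | no  _   | yes i≡b = inj₂ (inj₂ i≡b)
... | no  i≢a | no  i≢b = inj₁ (∧-intro (≠ᵇ-intro i≢a) (≠ᵇ-intro i≢b))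

data Hits² (i j : ℕ) : Edge → Set where
  up   : Hits² i j (i , j)
  down : Hits² i j (j , i)

misses⊎hits² : ∀ {i j} → i ≢ j → ∀ e → (Misses i e ⊎ Misses j e) ⊎ Hits² i j e
misses⊎hits² {i} {j} i≢j e with misses⊎hits i e | misses⊎hits j e
... | inj₁ m | _ = inj₁ (inj₁ m)
... | inj₂ _ | inj₁ m = inj₁ (inj₂ m)
... | inj₂ (inj₁ refl) | inj₂ (inj₁ refl) = contradiction refl i≢j
... | inj₂ (inj₁ refl) | inj₂ (inj₂ refl) = inj₂ up
... | inj₂ (inj₂ refl) | inj₂ (inj₁ refl) = inj₂ down
... | inj₂ (inj₂ refl) | inj₂ (inj₂ refl) = contradiction refl i≢j

-- An edge through both i and σ(i) is {i, σ(i)}. Of its two orders one is not increasing, and the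
-- other is ruled out by `ch₁` for a step and by `ch₂` for a wrap.
chord-misses : ∀ {n i j} e → 2 ≤ n → Next n i j → Valid n e → Chord n e → Misses i e ⊎ Misses j e
chord-misses {n} {i} e 2≤n nx (a<b , _) (ch₁ , ch₂) with misses⊎hits² (Next-irrefl 2≤n nx) e
... | inj₁ m = m
chord-misses {i = i} _ _ (step _) _ (ch₁ , _) | inj₂ up = contradiction refl (≠ᵇ-elim {suc i} ch₁)
chord-misses {i = i} _ _ (step _) (a<b , _) _ | inj₂ down = contradiction a<b (ℕ.<-asym (ℕ.n<1+n i))
chord-misses {i = i} _ _ (wrap refl) (() , _) _ | inj₂ up
chord-misses {i = i} _ _ (wrap refl) _ (_ , ch₂) | inj₂ down = contradiction (ℕ.≡⇒≡ᵇ i i refl) (¬T-not ch₂)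

-- If both edges of a pair met i and σ(i), both would be the increasing pair on {i, σ(i)}, hence
-- equal.
admissible-misses : ∀ {n i j} ((e , f) : Class) → 2 ≤ n → Next n i j → Admissible n (e , f) →
  (Misses i e ⊎ Misses j e) ⊎ (Misses i f ⊎ Misses j f)
admissible-misses (e , f) 2≤n nx ((valid , _) , inj₂ chord) = inj₁ (chord-misses e 2≤n nx valid chord)
admissible-misses (e , f) 2≤n nx (((e< , _) , (f< , _)) , inj₁ e≢f)
  with misses⊎hits² (Next-irrefl 2≤n nx) e | misses⊎hits² (Next-irrefl 2≤n nx) f
... | inj₁ m | _      = inj₁ m
... | inj₂ _ | inj₁ m = inj₂ m
... | inj₂ up   | inj₂ up   = contradiction e≢f (distinct-irrefl e)
... | inj₂ up   | inj₂ down = contradiction f< (ℕ.<-asym e<)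
... | inj₂ down | inj₂ up   = contradiction f< (ℕ.<-asym e<)
... | inj₂ down | inj₂ down = contradiction e≢f (distinct-irrefl e)

-- u, v, u′, v′ are the vertices 0, 1, 2, 3, and the old vertex i becomes 4 + i.
shiftᵉ : Edge → Edge
shiftᵉ (a , b) = 4 + a , 4 + b

shift : Class → Class
shift (e , f) = shiftᵉ e , shiftᵉ f

valid-shift : ∀ {n} e → Valid n e → Valid (4 + n) (shiftᵉ e)
valid-shift e (a<b , b<n) = ℕ.+-monoʳ-< 4 a<b , ℕ.+-monoʳ-< 4 b<n

-- Shifting preserves whether endpoints are consecutive, and a shifted edge avoids 0, so it is not
-- the closing edge of the longer cycle.
admissible-shift : ∀ {n A} → Admissible n A → Admissible (4 + n) (shift A)
admissible-shift {A = e , f} ((v , w) , inj₁ d)         = (valid-shift e v , valid-shift f w) , inj₁ d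
admissible-shift {A = e , f} ((v , w) , inj₂ (ch₁ , _)) = (valid-shift e v , valid-shift f w) , inj₂ (ch₁ , _)

-- The form `3 + m` provides n ≥ 3, without which σ could have a 2-cycle, and lets `newList` unfold
-- to its first two entries.
module Step {m l : ℕ} (F : Family (3 + m) l) where
  open Family F renaming (first to F₁; second to F₂)

  n : ℕ
  n = 3 + m

  e₁ f₁ e₂ f₂ : Edge
  e₁ = proj₁ F₁
  f₁ = proj₂ F₁
  e₂ = proj₁ F₂
  f₂ = proj₂ F₂

  nx : ∀ i → Next n i (next n i)
  nx = next-view n

  2≤n : 2 ≤ n
  2≤n = s≤s (s≤s z≤n)

  3≤n : 3 ≤ n
  3≤n = s≤s (s≤s (s≤s z≤n))

  next-misses : ∀ i A → Admissible n A →
    (Misses i (proj₁ A) ⊎ Misses (next n i) (proj₁ A)) ⊎ (Misses i (proj₂ A) ⊎ Misses (next n i) (proj₂ A))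
  next-misses i A = admissible-misses A 2≤n (nx i)

  no-2-cycle : ∀ i j → T (i ≠ᵇ next n j) ⊎ T (next n i ≠ᵇ j)
  no-2-cycle i j with i ℕ.≟ next n j
  ... | no  i≢ = inj₁ (≠ᵇ-intro i≢)
  ... | yes i≡ = inj₂ (≠ᵇ-intro λ ≡j →
    Next-asym 3≤n (subst (Next n i) ≡j (nx i)) (subst (Next n j) (sym i≡) (nx j)))

  next-≠ : ∀ {i j} → i ≢ j → T (next n i ≠ᵇ next n j)
  next-≠ {i} {j} i≢j = ≠ᵇ-intro λ eq → i≢j (Next-injective (subst (Next n i) eq (nx i)) (nx j))

  P Q : ℕ → Class
  P i = (0 , 4 + i) , (1 , 4 + next n i)
  Q i = (2 , 4 + i) , (3 , 4 + next n i)

  S₁ S₂ T₁ T₂ T₃ T₄ : Class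
  S₁ = (0 , 2) , (0 , 2)
  S₂ = (1 , 3) , (1 , 3)
  T₁ = (0 , 1) , shiftᵉ e₁
  T₂ = (2 , 3) , shiftᵉ f₁
  T₃ = (0 , 3) , shiftᵉ e₂
  T₄ = (1 , 2) , shiftᵉ f₂

  core : List Class
  core = S₁ ∷ S₂ ∷ T₁ ∷ T₂ ∷ T₃ ∷ T₄ ∷ []

  -- Here ui is disjoint from vσ(j) unless i = σ(j), and vσ(i) from uj unless j = σ(i). Both fail
  -- only if σ swaps i and j.
  PP : ∀ {i j} → i ≢ j → Compatible (P i) (P j)
  PP {i} {j} i≢j = (≠ᵇ-intro i≢j , _ , _ , next-≠ i≢j) ,
    [ (λ p → inj₂ (inj₁ p)) , (λ p → inj₂ (inj₂ (inj₁ p))) ]′ (no-2-cycle i j)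

  QQ : ∀ {i j} → i ≢ j → Compatible (Q i) (Q j)
  QQ {i} {j} i≢j = (≠ᵇ-intro i≢j , _ , _ , next-≠ i≢j) ,
    [ (λ p → inj₂ (inj₁ p)) , (λ p → inj₂ (inj₂ (inj₁ p))) ]′ (no-2-cycle i j)

  -- For i ≠ j use ui and u′j; for i = j use ui and v′σ(i), as σ has no fixed point.
  PQ : ∀ i j → Compatible (P i) (Q j)
  PQ i j with i ℕ.≟ j
  ... | no i≢j   = _ , inj₁ (≠ᵇ-intro i≢j)
  ... | yes refl = _ , inj₂ (inj₁ (≠ᵇ-intro (Next-irrefl 2≤n (nx i))))

  -- An old edge that misses i is disjoint from ui, and one that misses σ(i) is disjoint from vσ(i).
  P-old : ∀ i {A} → Admissible n A → Compatible (P i) (shift A)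
  P-old i {A} adm with next-misses i A adm
  ... | inj₁ (inj₁ p) = _ , inj₁ p
  ... | inj₁ (inj₂ p) = _ , inj₂ (inj₂ (inj₁ p))
  ... | inj₂ (inj₁ p) = _ , inj₂ (inj₁ p)
  ... | inj₂ (inj₂ p) = _ , inj₂ (inj₂ (inj₂ p))

  Q-old : ∀ i {A} → Admissible n A → Compatible (Q i) (shift A)
  Q-old i {A} adm with next-misses i A adm
  ... | inj₁ (inj₁ p) = _ , inj₁ p
  ... | inj₁ (inj₂ p) = _ , inj₂ (inj₂ (inj₁ p))
  ... | inj₂ (inj₁ p) = _ , inj₂ (inj₁ p)
  ... | inj₂ (inj₂ p) = _ , inj₂ (inj₂ (inj₂ p))

  adm₁ : Admissible n F₁
  adm₁ = All.head admissible

  adm₂ : Admissible n F₂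
  adm₂ = All.head (All.tail admissible)

  adm-others : All (Admissible n) others
  adm-others = All.tail (All.tail admissible)

  -- Since uv meets both edges of `P i`, the class `T₁` reaches `P i` only through `e₁`; this is
  -- what `first-chords` is for. Likewise `f₁` for `T₂` and `Q i`.
  e₁-misses : ∀ i → Misses i e₁ ⊎ Misses (next n i) e₁
  e₁-misses i = chord-misses e₁ 2≤n (nx i) (proj₁ (proj₁ adm₁)) (proj₁ first-chords)

  f₁-misses : ∀ i → Misses i f₁ ⊎ Misses (next n i) f₁
  f₁-misses i = chord-misses f₁ 2≤n (nx i) (proj₂ (proj₁ adm₁)) (proj₂ first-chords)

  P-core : ∀ i → All (Compatible (P i)) core
  P-core i =
    (_ , inj₂ (inj₂ (inj₁ _))) ∷ (_ , inj₁ _) ∷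
    (_ , [ (λ p → inj₂ (inj₁ p)) , (λ p → inj₂ (inj₂ (inj₂ p))) ]′ (e₁-misses i)) ∷
    (_ , inj₁ _) ∷ (_ , inj₂ (inj₂ (inj₁ _))) ∷ (_ , inj₁ _) ∷ []

  Q-core : ∀ i → All (Compatible (Q i)) core
  Q-core i =
    (_ , inj₂ (inj₂ (inj₁ _))) ∷ (_ , inj₁ _) ∷ (_ , inj₁ _) ∷
    (_ , [ (λ p → inj₂ (inj₁ p)) , (λ p → inj₂ (inj₂ (inj₂ p))) ]′ (f₁-misses i)) ∷
    (_ , inj₁ _) ∷ (_ , inj₂ (inj₂ (inj₁ _))) ∷ []

  -- New edges are disjoint from old ones, and uu′ from vv′, uv from u′v′, uv′ from u′v. What needs
  -- an argument is that `e₁`, `f₁`, `e₂`, `f₂` are distinct.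
  core-core : AllPairs Compatible core
  core-core with ((d₁ , d₂ , d₃ , d₄) , _) ← All.head (AllPairs.head compatible) =
    ((_ , inj₁ _) ∷ (_ , inj₂ (inj₁ _)) ∷ (_ , inj₂ (inj₁ _)) ∷ (_ , inj₂ (inj₁ _)) ∷ (_ , inj₂ (inj₁ _)) ∷ []) ∷
    ((_ , inj₂ (inj₁ _)) ∷ (_ , inj₂ (inj₁ _)) ∷ (_ , inj₂ (inj₁ _)) ∷ (_ , inj₂ (inj₁ _)) ∷ []) ∷
    (((_ , _ , _ , first-pair) , inj₁ _) ∷ ((_ , _ , _ , d₁) , inj₂ (inj₁ _)) ∷
     ((_ , _ , _ , d₂) , inj₂ (inj₁ _)) ∷ []) ∷
    (((_ , _ , _ , d₃) , inj₂ (inj₁ _)) ∷ ((_ , _ , _ , d₄) , inj₂ (inj₁ _)) ∷ []) ∷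
    (((_ , _ , _ , second-pair) , inj₁ _) ∷ []) ∷
    [] ∷ []

  -- The new edge in each core class is disjoint from every old edge. That the old edge in a `T`
  -- class does not recur is inherited from the dissolved class it came from.
  core-old : All (λ A → All (Compatible A) (map shift others)) core
  core-old =
    all-old S₁ (λ _ _ → _ , inj₁ _) ∷ all-old S₂ (λ _ _ → _ , inj₁ _) ∷
    all-old T₁ (λ { ((d₁ , d₂ , _ , _) , _) _ → (_ , _ , d₁ , d₂) , inj₁ _ }) ∷
    all-old T₂ (λ { ((_ , _ , d₃ , d₄) , _) _ → (_ , _ , d₃ , d₄) , inj₁ _ }) ∷
    all-old T₃ (λ { _ ((d₁ , d₂ , _ , _) , _) → (_ , _ , d₁ , d₂) , inj₁ _ }) ∷
    all-old T₄ (λ { _ ((_ , _ , d₃ , d₄) , _) → (_ , _ , d₃ , d₄) , inj₁ _ }) ∷ []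
    where
    all-old : ∀ B → (∀ {A} → Compatible F₁ A → Compatible F₂ A → Compatible B (shift A)) →
      All (Compatible B) (map shift others)
    all-old B f = All.map⁺ (All.zipWith (λ {A} (r₁ , r₂) → f {A} r₁ r₂)
      (All.tail (AllPairs.head compatible) , AllPairs.head (AllPairs.tail compatible)))

  newList : List Class
  newList = applyUpTo P n ++ (applyUpTo Q n ++ (core ++ map shift others))

  compatible′ : AllPairs Compatible newList
  compatible′ =
    AllPairs.++⁺ (AllPairs.applyUpTo⁺₁ P n λ i<j _ → PP (ℕ.<⇒≢ i<j))
      (AllPairs.++⁺ (AllPairs.applyUpTo⁺₁ Q n λ i<j _ → QQ (ℕ.<⇒≢ i<j))
        (AllPairs.++⁺ core-core (AllPairs.map⁺ (AllPairs.tail (AllPairs.tail compatible))) core-old)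
        (All.applyUpTo⁺₂ Q n λ i → All.++⁺ (Q-core i) (All.map⁺ (All.map (Q-old i) adm-others))))
      (All.applyUpTo⁺₂ P n λ i → All.++⁺ (All.applyUpTo⁺₂ Q n (PQ i))
        (All.++⁺ (P-core i) (All.map⁺ (All.map (P-old i) adm-others))))

  P-admissible : ∀ {i} → i < n → Admissible (4 + n) (P i)
  P-admissible {i} i<n =
    ((s≤s z≤n , ℕ.+-monoʳ-< 4 i<n) , (s≤s (s≤s z≤n) , ℕ.+-monoʳ-< 4 (Next-< i<n (nx i)))) , inj₁ _

  Q-admissible : ∀ {i} → i < n → Admissible (4 + n) (Q i)
  Q-admissible {i} i<n =
    ((s≤s (s≤s (s≤s z≤n)) , ℕ.+-monoʳ-< 4 i<n) ,
     (s≤s (s≤s (s≤s (s≤s z≤n))) , ℕ.+-monoʳ-< 4 (Next-< i<n (nx i)))) , inj₁ _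

  core-admissible : All (Admissible (4 + n)) core
  core-admissible =
    ((v₀₂ , v₀₂) , inj₂ _) ∷ ((v₁₃ , v₁₃) , inj₂ _) ∷
    ((v₀₁ , valid-shift e₁ (proj₁ (proj₁ adm₁))) , inj₁ _) ∷
    ((v₂₃ , valid-shift f₁ (proj₂ (proj₁ adm₁))) , inj₁ _) ∷
    ((v₀₃ , valid-shift e₂ (proj₁ (proj₁ adm₂))) , inj₁ _) ∷
    ((v₁₂ , valid-shift f₂ (proj₂ (proj₁ adm₂))) , inj₁ _) ∷ []
    where
    new : ∀ {a b} {_ : True (a ℕ.<? b)} {_ : True (b ℕ.<? 4)} → Valid (4 + n) (a , b)
    new {_} {_} {a<b} {b<4} = toWitness a<b , ℕ.≤-trans (toWitness b<4) (ℕ.m≤m+n 4 n)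
    v₀₁ = new {0} {1}
    v₀₂ = new {0} {2}
    v₀₃ = new {0} {3}
    v₁₂ = new {1} {2}
    v₁₃ = new {1} {3}
    v₂₃ = new {2} {3}

  admissible′ : All (Admissible (4 + n)) newList
  admissible′ = All.++⁺ (All.applyUpTo⁺₁ P n P-admissible) (All.++⁺ (All.applyUpTo⁺₁ Q n Q-admissible)
    (All.++⁺ core-admissible (All.map⁺ (All.map admissible-shift adm-others))))

  -- There are n classes `P i` and n classes `Q i`, and the six core classes replace two old ones.
  size′ : length newList ≡ l + 2 * n + 4
  size′ = begin
    length newList                                              ≡⟨ length-++ (applyUpTo P n) ⟩
    length (applyUpTo P n) + length (applyUpTo Q n ++ (core ++ map shift others))
      ≡⟨ cong₂ _+_ (length-applyUpTo P n) (length-++ (applyUpTo Q n)) ⟩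
    n + (length (applyUpTo Q n) + (6 + length (map shift others)))
      ≡⟨ cong₂ (λ x y → n + (x + (6 + y))) (length-applyUpTo Q n) (length-map shift others) ⟩
    n + (n + (6 + length others))                               ≡⟨ arith n (length others) ⟩
    2 + length others + 2 * n + 4                               ≡⟨ cong (λ x → x + 2 * n + 4) size ⟩
    l + 2 * n + 4                                               ∎
    where
    open ≡-Reasoning
    arith : ∀ n k → n + (n + (6 + k)) ≡ 2 + k + 2 * n + 4
    arith = solve-∀

  nextFamily : Family (4 + n) (l + 2 * n + 4)
  nextFamily = record
    -- The edges {0, 4} and {1, 4 + σ(0)} of `P 0` lie off the cycle on 4 + n vertices, so `P 0` can
    -- be dissolved next.
    { first = P 0 ; second = P 1
    ; compatible = compatible′ ; admissible = admissible′
    ; first-chords = _ ; first-pair = _ ; second-pair = _ ; size = size′ }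

-- In each base family ⌊n/2⌋ disjoint chords are singletons and all other edges are paired, so the
-- counting bound is met exactly.
family₈ : Family 8 16
family₈ = checkedFamily 8 ((0 , 4) , (1 , 7)) ((0 , 1) , (5 , 6))
  ( ((0 , 3) , (4 , 5)) ∷ ((0 , 5) , (1 , 4)) ∷ ((0 , 6) , (3 , 5)) ∷ ((0 , 7) , (3 , 6)) ∷
    ((1 , 2) , (4 , 7)) ∷ ((1 , 5) , (2 , 6)) ∷ ((1 , 6) , (2 , 7)) ∷ ((2 , 3) , (6 , 7)) ∷
    ((2 , 4) , (3 , 7)) ∷ ((2 , 5) , (3 , 4)) ∷ ((0 , 2) , (0 , 2)) ∷ ((1 , 3) , (1 , 3)) ∷
    ((4 , 6) , (4 , 6)) ∷ ((5 , 7) , (5 , 7)) ∷ [] )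

family₉ : Family 9 20
family₉ = checkedFamily 9 ((0 , 3) , (4 , 7)) ((0 , 1) , (5 , 8))
  ( ((0 , 4) , (7 , 8)) ∷ ((0 , 5) , (1 , 4)) ∷ ((0 , 6) , (3 , 7)) ∷ ((0 , 7) , (1 , 6)) ∷
    ((0 , 8) , (6 , 7)) ∷ ((1 , 2) , (4 , 8)) ∷ ((1 , 5) , (2 , 8)) ∷ ((1 , 7) , (2 , 4)) ∷
    ((1 , 8) , (2 , 6)) ∷ ((2 , 3) , (5 , 6)) ∷ ((2 , 5) , (3 , 4)) ∷ ((2 , 7) , (3 , 6)) ∷
    ((3 , 5) , (6 , 8)) ∷ ((3 , 8) , (4 , 5)) ∷ ((0 , 2) , (0 , 2)) ∷ ((1 , 3) , (1 , 3)) ∷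
    ((4 , 6) , (4 , 6)) ∷ ((5 , 7) , (5 , 7)) ∷ [] )

family₁₀ : Family 10 25
family₁₀ = checkedFamily 10 ((0 , 3) , (4 , 8)) ((0 , 1) , (4 , 7))
  ( ((0 , 4) , (5 , 9)) ∷ ((0 , 5) , (1 , 7)) ∷ ((0 , 6) , (3 , 8)) ∷ ((0 , 7) , (3 , 5)) ∷
    ((0 , 8) , (6 , 9)) ∷ ((0 , 9) , (5 , 6)) ∷ ((1 , 2) , (4 , 5)) ∷ ((1 , 4) , (2 , 9)) ∷
    ((1 , 5) , (2 , 6)) ∷ ((1 , 6) , (8 , 9)) ∷ ((1 , 8) , (4 , 9)) ∷ ((1 , 9) , (2 , 5)) ∷
    ((2 , 3) , (6 , 7)) ∷ ((2 , 4) , (3 , 9)) ∷ ((2 , 7) , (6 , 8)) ∷ ((2 , 8) , (3 , 7)) ∷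
    ((3 , 4) , (5 , 7)) ∷ ((3 , 6) , (7 , 8)) ∷ ((0 , 2) , (0 , 2)) ∷ ((1 , 3) , (1 , 3)) ∷
    ((4 , 6) , (4 , 6)) ∷ ((5 , 8) , (5 , 8)) ∷ ((7 , 9) , (7 , 9)) ∷ [] )

family₁₁ : Family 11 30
family₁₁ = checkedFamily 11 ((0 , 3) , (5 , 8)) ((0 , 1) , (6 , 9))
  ( ((0 , 4) , (1 , 7)) ∷ ((0 , 5) , (3 , 10)) ∷ ((0 , 6) , (7 , 9)) ∷ ((0 , 7) , (6 , 10)) ∷
    ((0 , 8) , (1 , 6)) ∷ ((0 , 9) , (5 , 10)) ∷ ((0 , 10) , (3 , 7)) ∷ ((1 , 2) , (7 , 10)) ∷
    ((1 , 4) , (2 , 8)) ∷ ((1 , 5) , (2 , 4)) ∷ ((1 , 8) , (4 , 5)) ∷ ((1 , 9) , (4 , 10)) ∷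
    ((1 , 10) , (6 , 7)) ∷ ((2 , 3) , (6 , 8)) ∷ ((2 , 5) , (9 , 10)) ∷ ((2 , 6) , (8 , 9)) ∷
    ((2 , 7) , (3 , 4)) ∷ ((2 , 9) , (4 , 7)) ∷ ((2 , 10) , (5 , 6)) ∷ ((3 , 5) , (4 , 8)) ∷
    ((3 , 6) , (5 , 9)) ∷ ((3 , 8) , (4 , 9)) ∷ ((3 , 9) , (7 , 8)) ∷ ((0 , 2) , (0 , 2)) ∷
    ((1 , 3) , (1 , 3)) ∷ ((4 , 6) , (4 , 6)) ∷ ((5 , 7) , (5 , 7)) ∷ ((8 , 10) , (8 , 10)) ∷ [] )

-- The binomial coefficient grows by 4n + 6 and ⌊n/2⌋ by 2; the sum 4n + 8 is even, so halving it
-- commutes with the floor.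
upperBound-+4 : ∀ n → upperBound n + 2 * n + 4 ≡ upperBound (4 + n)
upperBound-+4 n = begin
  upperBound n + 2 * n + 4                                ≡⟨ ℕ.+-assoc (upperBound n) (2 * n) 4 ⟩
  upperBound n + (2 * n + 4)                              ≡⟨ cong (upperBound n +_) (m*n/n≡m (2 * n + 4) 2) ⟨
  upperBound n + (2 * n + 4) * 2 / 2                      ≡⟨ +-distrib-/-∣ʳ (n C 2 + n / 2) (divides-refl (2 * n + 4)) ⟨
  (n C 2 + n / 2 + (2 * n + 4) * 2) / 2                   ≡⟨ cong (_/ 2) total ⟩
  upperBound (4 + n)                                      ∎
  where
  open ≡-Reasoning
  arith : ∀ n t h → t + h + (2 * n + 4) * 2 ≡ 3 + n + (2 + n + (1 + n + (n + t))) + (2 + h)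
  arith = solve-∀
  2+n/2 : (4 + n) / 2 ≡ 2 + n / 2
  2+n/2 = +-distrib-/-∣ˡ {4} n {2} (divides-refl 2)
  total : n C 2 + n / 2 + (2 * n + 4) * 2 ≡ (4 + n) C 2 + (4 + n) / 2
  total = begin
    n C 2 + n / 2 + (2 * n + 4) * 2                       ≡⟨ cong (λ t → t + n / 2 + (2 * n + 4) * 2) (triangle≡C n) ⟨
    triangle n + n / 2 + (2 * n + 4) * 2                  ≡⟨ arith n (triangle n) (n / 2) ⟩
    triangle (4 + n) + (2 + n / 2)                        ≡⟨ cong₂ _+_ (triangle≡C (4 + n)) (sym 2+n/2) ⟩
    (4 + n) C 2 + (4 + n) / 2                             ∎

family : ∀ r → Family (8 + r) (upperBound (8 + r))
family 0 = family₈
family 1 = family₉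
family 2 = family₁₀
family 3 = family₁₁
family (suc (suc (suc (suc r)))) =
  subst (Family (12 + r)) (upperBound-+4 (8 + r)) (Step.nextFamily (family r))

upperBound-attained : ∀ {n} → 8 ≤ n → IsPseudoachromaticNumber (Kneser2 n) (upperBound n)
upperBound-attained {n} 8≤n with r , refl ← ℕ.m≤n⇒∃[o]m+o≡n 8≤n =
  family⇒coloring (family r) , complete⇒≤upperBound n

lowerBound≤upperBound : ∀ n → lowerBound n ≤ upperBound n
lowerBound≤upperBound n = /-monoˡ-≤ 2 (ℕ.m≤m+n (n C 2) (n / 2))

-- Small cases

-- Reduction mod `l` only turns numerals into elements of `Fin l`.
table : ∀ l {k} .{{_ : NonZero l}} → Vec ℕ k → Vec (Fin l) k
table l = Vec.map (_mod l)

coloring : ∀ n l .{{_ : NonZero l}} (t : Vec ℕ (triangle n)) →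
  {True (surjective? (fromTable {n} (table l t)))} → {True (complete? (fromTable {n} (table l t)))} →
  HasCompleteColoring (Kneser2 n) l
coloring n l t {sur} {com} = fromTable (table l t) , toWitness sur , toWitness com

properColoring : ∀ n l .{{_ : NonZero l}} (t : Vec ℕ (triangle n)) →
  {True (surjective? (fromTable {n} (table l t)))} → {True (complete? (fromTable {n} (table l t)))} →
  {True (proper? (fromTable {n} (table l t)))} → HasProperCompleteColoring (Kneser2 n) l
properColoring n l t {sur} {com} {pro} = fromTable (table l t) , toWitness sur , toWitness com , toWitness pro

-- Proper complete colorings are complete, so one upper bound serves both numbers.
achromatic≡pseudoachromatic : ∀ {n l} → HasProperCompleteColoring (Kneser2 n) l →
  (∀ k → HasCompleteColoring (Kneser2 n) k → k ≤ l) →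
  IsPseudoachromaticNumber (Kneser2 n) l × IsAchromaticNumber (Kneser2 n) l
achromatic≡pseudoachromatic col@(c , sur , com , _) bound =
  ((c , sur , com) , bound) , (col , λ k (c , sur , com , _) → bound k (c , sur , com))

pairs⊎star-≤ : ∀ n {b} → triangle (2 + n) / 2 ≤ b → suc (triangle n) ≤ b →
  ∀ l → HasCompleteColoring (Kneser2 (2 + n)) l → l ≤ b
pairs⊎star-≤ n {b} pairs star l col with pairs⊎star {n} {l} col
... | inj₁ p = ℕ.≤-trans (subst (_≤ triangle (2 + n) / 2) (m*n/n≡m l 2) (/-monoˡ-≤ 2 p)) pairs
... | inj₂ p = ℕ.≤-trans p star

smallCase : ∀ r → r ≤ 4 →
  ∃[ k ] (IsPseudoachromaticNumber (Kneser2 (2 + r)) k × IsAchromaticNumber (Kneser2 (2 + r)) k)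
smallCase 0 _ = 1 , achromatic≡pseudoachromatic (properColoring 2 1 (0 ∷ []))
  (pairs⊎star-≤ 0 (from-yes (0 ℕ.≤? 1)) (from-yes (1 ℕ.≤? 1)))
smallCase 1 _ = 1 , achromatic≡pseudoachromatic (properColoring 3 1 (0 ∷ 0 ∷ 0 ∷ []))
  (pairs⊎star-≤ 1 (from-yes (1 ℕ.≤? 1)) (from-yes (1 ℕ.≤? 1)))
smallCase 2 _ = 3 , achromatic≡pseudoachromatic (properColoring 4 3 (1 ∷ 0 ∷ 0 ∷ 2 ∷ 1 ∷ 2 ∷ []))
  (pairs⊎star-≤ 2 (from-yes (3 ℕ.≤? 3)) (from-yes (2 ℕ.≤? 3)))
smallCase 3 _ = 5 , achromatic≡pseudoachromatic
  (properColoring 5 5 (2 ∷ 4 ∷ 4 ∷ 3 ∷ 2 ∷ 1 ∷ 3 ∷ 0 ∷ 0 ∷ 1 ∷ []))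
  (pairs⊎star-≤ 3 (from-yes (5 ℕ.≤? 5)) (from-yes (4 ℕ.≤? 5)))
smallCase 4 _ = 7 , achromatic≡pseudoachromatic
  (properColoring 6 7 (5 ∷ 6 ∷ 5 ∷ 2 ∷ 6 ∷ 1 ∷ 5 ∷ 2 ∷ 1 ∷ 0 ∷ 0 ∷ 4 ∷ 3 ∷ 3 ∷ 4 ∷ []))
  (pairs⊎star-≤ 4 (from-yes (7 ℕ.≤? 7)) (from-yes (7 ℕ.≤? 7)))
smallCase (suc (suc (suc (suc (suc _))))) (s≤s (s≤s (s≤s (s≤s ()))))

coloring₇ : HasCompleteColoring (Kneser2 7) 11
coloring₇ = coloring 7 11
  (7 ∷ 8 ∷ 5 ∷ 6 ∷ 3 ∷ 4 ∷ 10 ∷ 8 ∷ 9 ∷ 2 ∷ 5 ∷ 3 ∷ 7 ∷ 6 ∷ 1 ∷ 10 ∷ 4 ∷ 0 ∷ 0 ∷ 9 ∷ 0 ∷ [])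

-- 12 = upperBound 7; which alternative holds does not matter, so the search is never evaluated.
case₇ : Dec (HasCompleteColoring (Kneser2 7) 12) →
  ∃[ k ] (IsPseudoachromaticNumber (Kneser2 7) k × lowerBound 7 ≤ k × k ≤ upperBound 7)
case₇ (yes col) = 12 , (col , complete⇒≤upperBound 7) , from-yes (10 ℕ.≤? 12) , from-yes (12 ℕ.≤? 12)
case₇ (no ∄)    = 11 , (coloring₇ , ≤11) , from-yes (10 ℕ.≤? 11) , from-yes (11 ℕ.≤? 12)
  where
  ≤11 : ∀ l → HasCompleteColoring (Kneser2 7) l → l ≤ 11
  ≤11 l col = ℕ.≤-pred (ℕ.≤∧≢⇒< (complete⇒≤upperBound 7 l col) λ { refl → ∄ col })

theorem4p1 : ((n : ℕ) → 2 ≤ n → n ≤ 6 →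
    ∃[ k ] (IsPseudoachromaticNumber (Kneser2 n) k × IsAchromaticNumber (Kneser2 n) k))
    × ((n : ℕ) → 7 ≤ n →
    ∃[ k ] (IsPseudoachromaticNumber (Kneser2 n) k × lowerBound n ≤ k × k ≤ upperBound n))
    × ((n : ℕ) → 7 ≤ n → ((n + 1) % 20 ≡ 1 ⊎ (n + 1) % 20 ≡ 5) →
    IsPseudoachromaticNumber (Kneser2 n) (upperBound n))
theorem4p1 = small , bounds , exact
  where
  small : ∀ n → 2 ≤ n → n ≤ 6 →
    ∃[ k ] (IsPseudoachromaticNumber (Kneser2 n) k × IsAchromaticNumber (Kneser2 n) k)
  small (suc (suc r)) _ n≤6 = smallCase r (ℕ.≤-pred (ℕ.≤-pred n≤6))
  small 1 (s≤s ()) _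
  bounds : ∀ n → 7 ≤ n →
    ∃[ k ] (IsPseudoachromaticNumber (Kneser2 n) k × lowerBound n ≤ k × k ≤ upperBound n)
  bounds n 7≤n with n ℕ.≟ 7
  ... | yes refl = case₇ (hasCompleteColoring? 7 11)
  ... | no  n≢7  = upperBound n , upperBound-attained (ℕ.≤∧≢⇒< 7≤n (≢-sym n≢7)) ,
    lowerBound≤upperBound n , ℕ.≤-refl
  exact : ∀ n → 7 ≤ n → ((n + 1) % 20 ≡ 1 ⊎ (n + 1) % 20 ≡ 5) →
    IsPseudoachromaticNumber (Kneser2 n) (upperBound n)
  exact n 7≤n residue with n ℕ.≟ 7
  ... | no  n≢7  = upperBound-attained (ℕ.≤∧≢⇒< 7≤n (≢-sym n≢7))
  -- For n = 7 the residue of n + 1 is 8, so neither congruence holds.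
  exact .7 _ (inj₁ ()) | yes refl
  exact .7 _ (inj₂ ()) | yes refl
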